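{- Let $k\geq 1$ be an integer and let $G$ be a finite (not necessarily simple) graph with $e(G)>k\,(v(G)-1)$. Then $G$ contains a subgraph $G'$ such that: (i) $e(G')>k\,(v(G')-1)$; (ii) $G'$ is $(k+1)$-edge-connected; (iii) $G'$ contains $k$ pairwise edge-disjoint spanning trees; (iv) if $G$ is simple, then $v(G')>2k$.
   Context: Graphs may have parallel edges (loops are not considered). $v(G)$ and $e(G)$ denote the numbers of vertices and edges (counted with multiplicity). A graph $H$ is $(k+1)$-edge-connected if for every partition of $V(H)$ into two nonempty sets, at least $k+1$ edges join the two sets. -}

module Defs where

open import Data.Nat using (ℕ; suc; _∸_; _*_; _<_; _≤_)
open import Data.Fin using (Fin)
open import Data.Fin.Subset using (Subset; _∈_; _∉_; _⊆_; _∩_; ∣_∣; Empty; Nonempty)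
open import Data.Bool using (Bool; true; false; _xor_)
open import Data.Vec using (tabulate; lookup)
open import Data.List using (List; []; _∷_)
open import Data.List.Relation.Unary.Unique.Propositional using (Unique)
open import Data.Product using (_×_; _,_; proj₁; proj₂; Σ; ∃; ∃-syntax)
open import Data.Sum using (_⊎_)
open import Relation.Binary.PropositionalEquality using (_≡_; _≢_)
open import Relation.Nullary using (¬_)

record Graph : Set where
  field
    n    : ℕ
    m    : ℕ
    ends : Fin m → Fin n × Fin n
    noLoop : ∀ e → proj₁ (ends e) ≢ proj₂ (ends e)
open Graph public

v : Graph → ℕ
v G = n G

e : Graph → ℕ
e G = m G

Simple : Graph → Set
Simple G = ∀ a b → a ≢ b →
  ¬ ((ends G a ≡ ends G b) ⊎ (ends G a ≡ (proj₂ (ends G b) , proj₁ (ends G b))))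

record Subgraph (G : Graph) : Set where
  field
    S : Subset (n G)
    F : Subset (m G)
    closed : ∀ a → a ∈ F → (proj₁ (ends G a) ∈ S) × (proj₂ (ends G a) ∈ S)
open Subgraph public

vs : ∀ {G} → Subgraph G → ℕ
vs H = ∣ S H ∣

es : ∀ {G} → Subgraph G → ℕ
es H = ∣ F H ∣

Joins : (G : Graph) → Fin (m G) → Fin (n G) → Fin (n G) → Set
Joins G a x y = (ends G a ≡ (x , y)) ⊎ (ends G a ≡ (y , x))

data Walk (G : Graph) (T : Subset (m G)) : Fin (n G) → Fin (n G) → List (Fin (m G)) → Set where
  nil  : ∀ {x} → Walk G T x x []
  step : ∀ {x y z a w} → a ∈ T → Joins G a x y → Walk G T y z w → Walk G T x z (a ∷ w)

ConnectedOn : (G : Graph) → Subset (n G) → Subset (m G) → Set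
ConnectedOn G S T = ∀ x y → x ∈ S → y ∈ S → ∃[ w ] Walk G T x y w

Acyclic : (G : Graph) → Subset (m G) → Set
Acyclic G T = ∀ x w → Walk G T x x w → Unique w → w ≡ []

SpanningTree : ∀ {G} → Subgraph G → Subset (m G) → Set
SpanningTree {G} H T = T ⊆ F H × ConnectedOn G (S H) T × Acyclic G T

HasDisjointSpanningTrees : ∀ {G} → ℕ → Subgraph G → Set
HasDisjointSpanningTrees {G} j H =
  Σ (Fin j → Subset (m G)) λ T →
    (∀ i → SpanningTree H (T i)) × (∀ i i′ → i ≢ i′ → Empty (T i ∩ T i′))

crossing : ∀ {G} → Subgraph G → Subset (n G) → Subset (m G)
crossing {G} H A = tabulate λ a →
  lookup (F H) a Data.Bool.∧ (lookup A (proj₁ (ends G a)) xor lookup A (proj₂ (ends G a)))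
  where import Data.Bool

EdgeConnected : ∀ {G} → ℕ → Subgraph G → Set
EdgeConnected {G} j H = ∀ (A : Subset (n G)) → A ⊆ S H →
  Nonempty A → (∃ λ x → x ∈ S H × x ∉ A) → j ≤ ∣ crossing H A ∣

{-
Take a smallest vertex set S with e(S) > k (|S| − 1) and let G′ be the subgraph induced on S.  Proper
subsets A of S satisfy e(A) ≤ k (|A| − 1); adding this up over the two sides of a cut leaves more than
k crossing edges.  If G is simple, then k (|S| − 1) < e(S) ≤ |S| (|S| − 1) / 2, so |S| > 2k.

For the spanning trees, colour the edges of G′ one at a time with k colours so that every colour class
is a forest.  Not all edges can be coloured, since k forests on S have at most k (|S| − 1) edges.  When
an edge e₀ cannot be coloured even after exchanges (colour the missing edge and uncolour an edge of the
cycle it closes), let R be the set of all edges that become the missing one after some sequence of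
exchanges.  The ends of each edge of R are then joined by a path inside R in every colour class, so
each class, restricted to the vertex set U of the component of e₀ in R, is a spanning tree of U.
With e₀ this gives e(U) > k (|U| − 1), hence U = S by minimality.
-}
module Submission where

open import Defs
open import Data.Nat using (ℕ; zero; suc; _+_; _∸_; _*_; _<_; _≤_; z≤n; s≤s)
open import Data.Nat.Properties
open import Data.Nat.Solver using (module +-*-Solver)
open import Data.Bool using (true; false; _∧_; _xor_)
open import Data.Fin using (Fin; zero; suc)
open import Data.Fin.Properties using (any?) renaming (_≟_ to _≟ᶠ_; suc-injective to Fin-suc-injective)
open import Data.Fin.Subset using (Subset; inside; outside; _∈_; _∉_; _⊆_; _∪_; _∩_; _-_;
  ⊥; ⊤; ⁅_⁆; ∣_∣; Empty; Nonempty)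
open import Data.Fin.Subset.Properties
open import Data.Vec using ([]; _∷_; here; there; tabulate; lookup)
open import Data.Vec.Properties using (lookup∘tabulate; []=⇒lookup; lookup⇒[]=)
open import Data.Product using (_×_; Σ; _,_; proj₁; proj₂; ∃-syntax; swap)
import Data.Product.Properties as Product
open import Data.Sum using (_⊎_; inj₁; inj₂; [_,_]′)
open import Data.Empty using (⊥-elim)
open import Data.Maybe using (Maybe; just; nothing)
open import Data.Maybe.Properties using (≡-dec; just-injective)
open import Data.Vec.Functional using (updateAt)
open import Data.Vec.Functional.Properties using (updateAt-updates; updateAt-minimal)
open import Data.List using ([]; _∷_)
open import Data.List.Relation.Unary.All as All using (_∷_)
open import Data.List.Relation.Unary.AllPairs using (_∷_)
open import Data.List.Relation.Unary.Any using (here; there)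
open import Data.List.Membership.Propositional using () renaming (_∈_ to _∈ˡ_)
open import Relation.Binary.Construct.Closure.ReflexiveTransitive as Star using (Star; ε; _◅_; _◅◅_)
open import Function using (_∘_; id; const)
open import Relation.Nullary using (¬_; Dec; yes; no; does; contradiction; ¬?)
open import Relation.Nullary.Decidable using (_×-dec_; _⊎-dec_; map′; dec-true)
open import Relation.Unary using (Decidable)
open import Relation.Binary.PropositionalEquality

private
  variable
    N M k : ℕ

-- Finite sets

-- The later inductions on vertex and edge sets run through this principle: one new element enters
-- at a time, and `x ∉ p` lets `∣insert∣` raise the size by exactly one.
subset-induction : (Q : Subset N → Set) → Q ⊥ →
  (∀ p x → x ∉ p → Q p → Q (p ∪ ⁅ x ⁆)) → ∀ p → Q p
subset-induction Q base add [] = base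
subset-induction {suc N} Q base add (s ∷ p) = head s
  where
  Q-out : Q (outside ∷ p)
  Q-out = subset-induction (Q ∘ (outside ∷_)) base
    (λ q x x∉q → add (outside ∷ q) (suc x) (x∉q ∘ drop-there)) p
  head : ∀ s → Q (s ∷ p)
  head outside = Q-out
  head inside = subst (λ q → Q (inside ∷ q)) (∪-identityʳ p)
    (add (outside ∷ p) zero (λ ()) Q-out)

∈-insert⁻ : ∀ {p : Subset N} {x y} → y ∈ p ∪ ⁅ x ⁆ → y ∈ p ⊎ y ≡ x
∈-insert⁻ {p = p} {x} y∈ with x∈p∪q⁻ p ⁅ x ⁆ y∈
... | inj₁ y∈p = inj₁ y∈p
... | inj₂ y∈x = inj₂ (x∈⁅y⁆⇒x≡y x y∈x)

∈-insertˡ : ∀ {p : Subset N} {x y} → y ∈ p → y ∈ p ∪ ⁅ x ⁆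
∈-insertˡ y∈p = x∈p∪q⁺ (inj₁ y∈p)

∈-insertʳ : ∀ {p : Subset N} {x} → x ∈ p ∪ ⁅ x ⁆
∈-insertʳ {x = x} = x∈p∪q⁺ (inj₂ (x∈⁅x⁆ x))

∣p∪q∣+∣p∩q∣ : ∀ (p q : Subset N) → ∣ p ∪ q ∣ + ∣ p ∩ q ∣ ≡ ∣ p ∣ + ∣ q ∣
∣p∪q∣+∣p∩q∣ [] [] = refl
∣p∪q∣+∣p∩q∣ (outside ∷ p) (outside ∷ q) = ∣p∪q∣+∣p∩q∣ p q
∣p∪q∣+∣p∩q∣ (outside ∷ p) (inside ∷ q) =
  trans (cong suc (∣p∪q∣+∣p∩q∣ p q)) (sym (+-suc ∣ p ∣ ∣ q ∣))
∣p∪q∣+∣p∩q∣ (inside ∷ p) (outside ∷ q) = cong suc (∣p∪q∣+∣p∩q∣ p q)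
∣p∪q∣+∣p∩q∣ (inside ∷ p) (inside ∷ q) = cong suc
  (trans (+-suc ∣ p ∪ q ∣ ∣ p ∩ q ∣)
    (trans (cong suc (∣p∪q∣+∣p∩q∣ p q)) (sym (+-suc ∣ p ∣ ∣ q ∣))))

∣p∪q∣≤∣p∣+∣q∣ : ∀ (p q : Subset N) → ∣ p ∪ q ∣ ≤ ∣ p ∣ + ∣ q ∣
∣p∪q∣≤∣p∣+∣q∣ p q = ≤-trans (m≤m+n _ _) (≤-reflexive (∣p∪q∣+∣p∩q∣ p q))

disjoint⇒∣p∪q∣≡∣p∣+∣q∣ : ∀ (p q : Subset N) → Empty (p ∩ q) → ∣ p ∪ q ∣ ≡ ∣ p ∣ + ∣ q ∣
disjoint⇒∣p∪q∣≡∣p∣+∣q∣ {N} p q disj = begin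
  ∣ p ∪ q ∣              ≡⟨ +-identityʳ _ ⟨
  ∣ p ∪ q ∣ + 0          ≡⟨ cong (∣ p ∪ q ∣ +_) (∣⊥∣≡0 N) ⟨
  ∣ p ∪ q ∣ + ∣ ⊥ {N} ∣  ≡⟨ cong (λ r → ∣ p ∪ q ∣ + ∣ r ∣) (Empty-unique disj) ⟨
  ∣ p ∪ q ∣ + ∣ p ∩ q ∣  ≡⟨ ∣p∪q∣+∣p∩q∣ p q ⟩
  ∣ p ∣ + ∣ q ∣          ∎
  where open ≡-Reasoning

∣insert∣ : ∀ {p : Subset N} {x} → x ∉ p → ∣ p ∪ ⁅ x ⁆ ∣ ≡ suc ∣ p ∣
∣insert∣ {p = p} {x} x∉p = begin
  ∣ p ∪ ⁅ x ⁆ ∣      ≡⟨ disjoint⇒∣p∪q∣≡∣p∣+∣q∣ p ⁅ x ⁆ disj ⟩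
  ∣ p ∣ + ∣ ⁅ x ⁆ ∣  ≡⟨ cong (∣ p ∣ +_) (∣⁅x⁆∣≡1 x) ⟩
  ∣ p ∣ + 1          ≡⟨ +-comm ∣ p ∣ 1 ⟩
  suc ∣ p ∣          ∎
  where
  open ≡-Reasoning
  disj : Empty (p ∩ ⁅ x ⁆)
  disj (y , y∈) with x∈p∩q⁻ p ⁅ x ⁆ y∈
  ... | y∈p , y∈x rewrite x∈⁅y⁆⇒x≡y x y∈x = x∉p y∈p

suc∣p-x∣ : ∀ (p : Subset N) {x} → x ∈ p → suc ∣ p - x ∣ ≡ ∣ p ∣
suc∣p-x∣ (inside ∷ p) here = cong (suc ∘ ∣_∣) (p─⊥≡p p)
suc∣p-x∣ (outside ∷ p) (there x∈p) = suc∣p-x∣ p x∈p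
suc∣p-x∣ (inside ∷ p) (there x∈p) = cong suc (suc∣p-x∣ p x∈p)

x∉p-x : ∀ (p : Subset N) x → x ∉ p - x
x∉p-x (s ∷ p) (suc x) (there x∈) = x∉p-x p x x∈
x∉p-x (inside ∷ p) zero ()
x∉p-x (outside ∷ p) zero ()

x∈p⇒1≤∣p∣ : ∀ {p : Subset N} {x} → x ∈ p → 1 ≤ ∣ p ∣
x∈p⇒1≤∣p∣ {p = p} x∈p = subst (1 ≤_) (suc∣p-x∣ p x∈p) (s≤s z≤n)

module _ {P : Fin N → Set} (P? : Decidable P) where

  -- The bridge from decidable predicates, in which connectivity is phrased, to subsets, which can
  -- be counted.
  ⟦_⟧ : Subset N
  ⟦_⟧ = tabulate (does ∘ P?)

  ∈⟦⟧⁺ : ∀ {x} → P x → x ∈ ⟦_⟧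
  ∈⟦⟧⁺ {x} px = lookup⇒[]= x ⟦_⟧ (trans (lookup∘tabulate (does ∘ P?) x) (dec-true (P? x) px))

  ∈⟦⟧⁻ : ∀ {x} → x ∈ ⟦_⟧ → P x
  ∈⟦⟧⁻ {x} x∈ with P? x | trans (sym (lookup∘tabulate (does ∘ P?) x)) ([]=⇒lookup x∈)
  ... | yes px | _ = px
  ... | no _ | ()

⋃ᶠ : (Fin k → Subset N) → Subset N
⋃ᶠ {zero} T = ⊥
⋃ᶠ {suc k} T = T zero ∪ ⋃ᶠ (T ∘ suc)

∈⋃ᶠ⁺ : ∀ (T : Fin k → Subset N) i {x} → x ∈ T i → x ∈ ⋃ᶠ T
∈⋃ᶠ⁺ T zero x∈ = x∈p∪q⁺ (inj₁ x∈)
∈⋃ᶠ⁺ T (suc i) x∈ = x∈p∪q⁺ (inj₂ (∈⋃ᶠ⁺ (T ∘ suc) i x∈))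

∈⋃ᶠ⁻ : ∀ (T : Fin k → Subset N) {x} → x ∈ ⋃ᶠ T → ∃[ i ] x ∈ T i
∈⋃ᶠ⁻ {zero} T x∈ = contradiction x∈ ∉⊥
∈⋃ᶠ⁻ {suc k} T x∈ with x∈p∪q⁻ (T zero) (⋃ᶠ (T ∘ suc)) x∈
... | inj₁ x∈₀ = zero , x∈₀
... | inj₂ x∈₁ with ∈⋃ᶠ⁻ (T ∘ suc) x∈₁
...   | i , x∈ᵢ = suc i , x∈ᵢ

∣⋃ᶠ∣≤ : ∀ (T : Fin k → Subset N) s → (∀ i → ∣ T i ∣ ≤ s) → ∣ ⋃ᶠ T ∣ ≤ k * s
∣⋃ᶠ∣≤ {zero} {N} T s small = ≤-reflexive (∣⊥∣≡0 N)
∣⋃ᶠ∣≤ {suc k} T s small = ≤-trans (∣p∪q∣≤∣p∣+∣q∣ (T zero) (⋃ᶠ (T ∘ suc)))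
  (+-mono-≤ (small zero) (∣⋃ᶠ∣≤ (T ∘ suc) s (small ∘ suc)))

∣⋃ᶠ∣≥ : ∀ (T : Fin k → Subset N) s → (∀ i → s ≤ ∣ T i ∣) →
  (∀ i j {x} → x ∈ T i → x ∈ T j → i ≡ j) → k * s ≤ ∣ ⋃ᶠ T ∣
∣⋃ᶠ∣≥ {zero} T s big disj = z≤n
∣⋃ᶠ∣≥ {suc k} T s big disj = ≤-trans
  (+-mono-≤ (big zero) (∣⋃ᶠ∣≥ (T ∘ suc) s (big ∘ suc)
    λ i j x∈i x∈j → Fin-suc-injective (disj (suc i) (suc j) x∈i x∈j)))
  (≤-reflexive (sym (disjoint⇒∣p∪q∣≡∣p∣+∣q∣ (T zero) (⋃ᶠ (T ∘ suc)) empty)))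
  where
  empty : Empty (T zero ∩ ⋃ᶠ (T ∘ suc))
  empty (x , x∈) with x∈p∩q⁻ (T zero) _ x∈
  ... | x∈₀ , x∈₁ with ∈⋃ᶠ⁻ (T ∘ suc) x∈₁
  ...   | i , x∈ᵢ with disj zero (suc i) x∈₀ x∈ᵢ
  ...     | ()

-- The induction takes a partner of the new element and deletes it from `q`; by injectivity no other
-- element loses its partner.
∣∣≤-by-injective-relation : (_~_ : Fin M → Fin N → Set) (p : Subset M) (q : Subset N) →
  (∀ {a} → a ∈ p → ∃[ y ] y ∈ q × a ~ y) →
  (∀ {a b y} → a ~ y → b ~ y → a ≡ b) → ∣ p ∣ ≤ ∣ q ∣
∣∣≤-by-injective-relation {M} _~_ p q total injective =
  subset-induction (λ p → ∀ q → (∀ {a} → a ∈ p → ∃[ y ] y ∈ q × a ~ y) → ∣ p ∣ ≤ ∣ q ∣)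
    (λ q _ → subst (_≤ ∣ q ∣) (sym (∣⊥∣≡0 M)) z≤n) add p q total
  where
  add : ∀ p x → x ∉ p → (∀ q → (∀ {a} → a ∈ p → ∃[ y ] y ∈ q × a ~ y) → ∣ p ∣ ≤ ∣ q ∣) →
    ∀ q → (∀ {a} → a ∈ p ∪ ⁅ x ⁆ → ∃[ y ] y ∈ q × a ~ y) → ∣ p ∪ ⁅ x ⁆ ∣ ≤ ∣ q ∣
  add p x x∉p ih q tot with tot ∈-insertʳ
  ... | y , y∈q , x~y = subst₂ _≤_ (sym (∣insert∣ x∉p)) (suc∣p-x∣ q y∈q) (s≤s (ih (q - y) tot′))
    where
    tot′ : ∀ {a} → a ∈ p → ∃[ z ] z ∈ q - y × a ~ z
    tot′ a∈p with tot (∈-insertˡ a∈p)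
    ... | z , z∈q , a~z = z , x∈p∧x≢y⇒x∈p-y z∈q z≢y , a~z
      where
      z≢y : z ≢ y
      z≢y refl = x∉p (subst (_∈ p) (injective a~z x~y) a∈p)

-- A finite search in place of a classical case distinction; it collects the outcomes for all
-- colours and then for all edges in the search for an augmentation.
⊎-distribʳ-∀ : {A : Set} {B : Fin N → Set} → (∀ x → A ⊎ B x) → A ⊎ (∀ x → B x)
⊎-distribʳ-∀ {zero} f = inj₂ λ ()
⊎-distribʳ-∀ {suc N} f with f zero | ⊎-distribʳ-∀ (f ∘ suc)
... | inj₁ a | _ = inj₁ a
... | inj₂ _ | inj₁ a = inj₁ a
... | inj₂ b | inj₂ bs = inj₂ λ { zero → b ; (suc x) → bs x }

-- Connectivity and independent edge sets

module Connectivity (G : Graph) where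

  V E : Set
  V = Fin (n G)
  E = Fin (m G)

  src tgt : E → V
  src a = proj₁ (ends G a)
  tgt a = proj₂ (ends G a)

  Adjacent : (E → Set) → V → V → Set
  Adjacent P x y = ∃[ a ] P a × Joins G a x y

  Connected : (E → Set) → V → V → Set
  Connected P = Star (Adjacent P)

  Joins-sym : ∀ {a x y} → Joins G a x y → Joins G a y x
  Joins-sym (inj₁ eq) = inj₂ eq
  Joins-sym (inj₂ eq) = inj₁ eq

  Connected-sym : ∀ {P x y} → Connected P x y → Connected P y x
  Connected-sym = Star.reverse λ { (a , pa , j) → a , pa , Joins-sym j }

  Connected-mono : ∀ {P Q x y} → (∀ {a} → P a → Q a) → Connected P x y → Connected Q x y
  Connected-mono P⊆Q = Star.map λ { (a , pa , j) → a , P⊆Q pa , j }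

  Connected-edge : ∀ {P : E → Set} {a} → P a → Connected P (src a) (tgt a)
  Connected-edge pa = (_ , pa , inj₁ refl) ◅ ε

  Connected-replace : ∀ {P Q x y} → (∀ a → P a → Connected Q (src a) (tgt a)) →
    Connected P x y → Connected Q x y
  Connected-replace {Q = Q} f = Star.kleisliStar id λ where
    (a , pa , inj₁ refl) → f a pa
    (a , pa , inj₂ refl) → Connected-sym (f a pa)

  _⊹_ : (E → Set) → E → E → Set
  (P ⊹ a) b = P b ⊎ b ≡ a

  _∖_ : (E → Set) → E → E → Set
  (P ∖ a) b = P b × b ≢ a

  -- The walk can be shortened until it uses `a` at most once. If it starts with `a` and uses `a`
  -- again in the same direction, one use and the stretch between are dropped; if in the opposite
  -- direction, everything through the second use is dropped.
  Connected-⊹⁻ : ∀ {P a x y} → Connected (P ⊹ a) x y → Connected P x y ⊎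
    (Connected P x (src a) × Connected P (tgt a) y) ⊎
    (Connected P x (tgt a) × Connected P (src a) y)
  Connected-⊹⁻ ε = inj₁ ε
  Connected-⊹⁻ ((b , inj₁ pb , j) ◅ w) with Connected-⊹⁻ w
  ... | inj₁ zy = inj₁ ((b , pb , j) ◅ zy)
  ... | inj₂ (inj₁ (zs , ty)) = inj₂ (inj₁ ((b , pb , j) ◅ zs , ty))
  ... | inj₂ (inj₂ (zt , sy)) = inj₂ (inj₂ ((b , pb , j) ◅ zt , sy))
  Connected-⊹⁻ ((b , inj₂ refl , inj₁ refl) ◅ w) with Connected-⊹⁻ w
  ... | inj₁ ty = inj₂ (inj₁ (ε , ty))
  ... | inj₂ (inj₁ (_ , ty)) = inj₂ (inj₁ (ε , ty))
  ... | inj₂ (inj₂ (_ , sy)) = inj₁ sy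
  Connected-⊹⁻ ((b , inj₂ refl , inj₂ refl) ◅ w) with Connected-⊹⁻ w
  ... | inj₁ sy = inj₂ (inj₂ (ε , sy))
  ... | inj₂ (inj₁ (_ , ty)) = inj₁ ty
  ... | inj₂ (inj₂ (_ , sy)) = inj₂ (inj₂ (ε , sy))

  -- The walk in `P ⊹ a` has to use `a`. Its two remaining pieces lie in `Q`, and together with the
  -- `Q`-walk from `x` to `y` they join the ends of `a`.
  Connected-exchange : ∀ {P Q a x y} → (∀ {b} → P b → Q b) →
    ¬ Connected P x y → Connected (P ⊹ a) x y → Connected Q x y → Connected Q (src a) (tgt a)
  Connected-exchange P⊆Q ¬xy xy⁺ xy with Connected-⊹⁻ xy⁺
  ... | inj₁ xy′ = contradiction xy′ ¬xy
  ... | inj₂ (inj₁ (xs , ty)) = Connected-sym (Connected-mono P⊆Q xs) ◅◅ xy ◅◅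
    Connected-sym (Connected-mono P⊆Q ty)
  ... | inj₂ (inj₂ (xt , sy)) = Connected-mono P⊆Q sy ◅◅ Connected-sym xy ◅◅
    Connected-mono P⊆Q xt

  -- By `Connected-⊹⁻`, a question about `T ∪ ⁅ a ⁆` reduces to five questions about `T`.
  connected-∈? : ∀ T x y → Dec (Connected (_∈ T) x y)
  connected-∈? = subset-induction (λ T → ∀ x y → Dec (Connected (_∈ T) x y))
    (λ x y → map′ (λ { refl → ε }) (λ { ε → refl ; ((a , a∈ , _) ◅ _) → contradiction a∈ ∉⊥ }) (x ≟ᶠ y))
    λ T a _ ih x y → map′
      [ Connected-mono ∈-insertˡ ,
        [ (λ (xs , ty) → Connected-mono ∈-insertˡ xs ◅◅ Connected-edge ∈-insertʳ ◅◅
             Connected-mono ∈-insertˡ ty)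
        , (λ (xt , sy) → Connected-mono ∈-insertˡ xt ◅◅ Connected-sym (Connected-edge ∈-insertʳ) ◅◅
             Connected-mono ∈-insertˡ sy) ]′ ]′
      (Connected-⊹⁻ ∘ Connected-mono ∈-insert⁻)
      (ih x y ⊎-dec ((ih x (src a) ×-dec ih (tgt a) y) ⊎-dec (ih x (tgt a) ×-dec ih (src a) y)))

  connected? : ∀ {P} → Decidable P → ∀ x y → Dec (Connected P x y)
  connected? P? x y = map′ (Connected-mono (∈⟦⟧⁻ P?)) (Connected-mono (∈⟦⟧⁺ P?))
    (connected-∈? ⟦ P? ⟧ x y)

  -- Every edge is a bridge: this is independence in the cycle matroid. It avoids lists of edges and
  -- is easy to follow through exchanges; `independent⇒acyclic` recovers `Acyclic`.
  Independent : (E → Set) → Set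
  Independent P = ∀ a → P a → ¬ Connected (P ∖ a) (src a) (tgt a)

  Independent-⊆ : ∀ {P Q} → (∀ {a} → P a → Q a) → Independent Q → Independent P
  Independent-⊆ P⊆Q ind a pa = ind a (P⊆Q pa) ∘ Connected-mono λ (pb , b≢a) → P⊆Q pb , b≢a

  Independent-⊹ : ∀ {P f} → Independent P → ¬ Connected P (src f) (tgt f) → Independent (P ⊹ f)
  Independent-⊹ {P} {f} ind ¬f a (inj₂ refl) con = ¬f (Connected-mono strip con)
    where
    strip : ∀ {b} → ((P ⊹ a) ∖ a) b → P b
    strip (inj₁ pb , _) = pb
    strip (inj₂ b≡a , b≢a) = contradiction b≡a b≢a
  -- If an old edge `a` stops being a bridge, the walk around it uses `f`; the exchange then joins
  -- the ends of `f` inside `P`.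
  Independent-⊹ {P} {f} ind ¬f a (inj₁ pa) con =
    ¬f (Connected-exchange proj₁ (ind a pa) (Connected-mono regroup con) (Connected-edge pa))
    where
    regroup : ∀ {b} → ((P ⊹ f) ∖ a) b → ((P ∖ a) ⊹ f) b
    regroup (inj₁ pb , b≢a) = inj₁ (pb , b≢a)
    regroup (inj₂ b≡f , _) = inj₂ b≡f

  -- Add the edges of P outside R one at a time; the edge that first connects x and y lies on the
  -- unique P-path between them.
  cut-edge-outside : ∀ {P x y} → Decidable P → Independent P → (R : Subset (m G)) →
    Connected P x y → ¬ Connected (λ b → P b × b ∈ R) x y →
    ∃[ a ] a ∉ R × P a × ¬ Connected (P ∖ a) x y
  cut-edge-outside {P} {x} {y} P? ind R xy ¬xy = subset-induction Q base add ⊤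
    (Connected-mono (λ pb → pb , inj₂ ∈⊤) xy)
    where
    P∩ : Subset (m G) → E → Set
    P∩ W b = P b × (b ∈ R ⊎ b ∈ W)
    Q : Subset (m G) → Set
    Q W = Connected (P∩ W) x y → ∃[ a ] a ∉ R × P a × ¬ Connected (P ∖ a) x y
    base : Q ⊥
    base con = contradiction (Connected-mono (λ { (pb , inj₁ b∈R) → pb , b∈R
                                                ; (pb , inj₂ b∈⊥) → contradiction b∈⊥ ∉⊥ }) con) ¬xy
    add : ∀ W a → a ∉ W → Q W → Q (W ∪ ⁅ a ⁆)
    add W a a∉W ih con with connected? (λ b → P? b ×-dec (b ∈? R ⊎-dec b ∈? W)) x y
    ... | yes con′ = ih con′
    ... | no ¬con′ with P? a | a ∈? R
    ...   | no ¬pa | _ = contradiction (Connected-mono shrink con) ¬con′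
      where
      shrink : ∀ {b} → P∩ (W ∪ ⁅ a ⁆) b → P∩ W b
      shrink (pb , inj₁ b∈R) = pb , inj₁ b∈R
      shrink (pb , inj₂ b∈) with ∈-insert⁻ b∈
      ... | inj₁ b∈W = pb , inj₂ b∈W
      ... | inj₂ refl = contradiction pb ¬pa
    ...   | _ | yes a∈R = contradiction (Connected-mono shrink con) ¬con′
      where
      shrink : ∀ {b} → P∩ (W ∪ ⁅ a ⁆) b → P∩ W b
      shrink (pb , inj₁ b∈R) = pb , inj₁ b∈R
      shrink (pb , inj₂ b∈) with ∈-insert⁻ b∈
      ... | inj₁ b∈W = pb , inj₂ b∈W
      ... | inj₂ refl = pb , inj₁ a∈R
    ...   | yes pa | no a∉R = a , a∉R , pa , λ xy′ →
      ind a pa (Connected-exchange avoid ¬con′ (Connected-mono split con) xy′)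
      where
      avoid : ∀ {b} → P∩ W b → (P ∖ a) b
      avoid (pb , inj₁ b∈R) = pb , λ { refl → a∉R b∈R }
      avoid (pb , inj₂ b∈W) = pb , λ { refl → a∉W b∈W }
      split : ∀ {b} → P∩ (W ∪ ⁅ a ⁆) b → (P∩ W ⊹ a) b
      split (pb , inj₁ b∈R) = inj₁ (pb , inj₁ b∈R)
      split (pb , inj₂ b∈) with ∈-insert⁻ b∈
      ... | inj₁ b∈W = inj₁ (pb , inj₂ b∈W)
      ... | inj₂ b≡a = inj₂ b≡a

  -- Counting the edges of a forest

  Inside : Subset (n G) → E → Set
  Inside U a = src a ∈ U × tgt a ∈ U

  inside? : ∀ U → Decidable (Inside U)
  inside? U a = src a ∈? U ×-dec tgt a ∈? U

  -- One vertex from each component of the graph with vertex set `U` and edge set `T`. The field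
  -- `count` is the forest formula (components plus edges equals vertices), written additively to
  -- avoid truncated subtraction.
  record Representatives (U : Subset (n G)) (T : Subset (m G)) : Set where
    field
      reps       : Subset (n G)
      reps⊆      : reps ⊆ U
      dominating : ∀ {x} → x ∈ U → ∃[ c ] c ∈ reps × Connected (_∈ T) x c
      separated  : ∀ {c d} → c ∈ reps → d ∈ reps → Connected (_∈ T) c d → c ≡ d
      count      : ∣ reps ∣ + ∣ T ∣ ≡ ∣ U ∣

  -- Without edges every vertex represents itself. By independence each new edge merges two
  -- different components, and one of their two representatives is discarded.
  representatives : ∀ U T → (∀ {a} → a ∈ T → Inside U a) → Independent (_∈ T) → Representatives U T
  representatives U = subset-induction
    (λ T → (∀ {a} → a ∈ T → Inside U a) → Independent (_∈ T) → Representatives U T) base add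
    where
    open Representatives
    base : (∀ {a} → a ∈ ⊥ → Inside U a) → Independent (_∈ ⊥) → Representatives U ⊥
    base _ _ .reps = U
    base _ _ .reps⊆ = id
    base _ _ .dominating x∈ = _ , x∈ , ε
    base _ _ .separated _ _ ε = refl
    base _ _ .separated _ _ ((_ , a∈ , _) ◅ _) = contradiction a∈ ∉⊥
    base _ _ .count = trans (cong (∣ U ∣ +_) (∣⊥∣≡0 (m G))) (+-identityʳ _)
    add : ∀ T a → a ∉ T → ((∀ {b} → b ∈ T → Inside U b) → Independent (_∈ T) → Representatives U T) →
      (∀ {b} → b ∈ T ∪ ⁅ a ⁆ → Inside U b) → Independent (_∈ T ∪ ⁅ a ⁆) → Representatives U (T ∪ ⁅ a ⁆)
    add T a a∉T ih ins ind = result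
      where
      old : Representatives U T
      old = ih (ins ∘ ∈-insertˡ) (Independent-⊆ ∈-insertˡ ind)
      ¬st : ¬ Connected (_∈ T) (src a) (tgt a)
      ¬st = ind a ∈-insertʳ ∘ Connected-mono λ b∈T → ∈-insertˡ b∈T , λ { refl → a∉T b∈T }
      lift : ∀ {x y} → Connected (_∈ T) x y → Connected (_∈ T ∪ ⁅ a ⁆) x y
      lift = Connected-mono ∈-insertˡ
      module _ {c d} (c∈ : c ∈ old .reps) (sc : Connected (_∈ T) (src a) c)
                     (d∈ : d ∈ old .reps) (td : Connected (_∈ T) (tgt a) d) where
        c≢d : c ≢ d
        c≢d refl = ¬st (sc ◅◅ Connected-sym td)
        new : Representatives U (T ∪ ⁅ a ⁆)
        new .reps = old .reps - d
        new .reps⊆ = old .reps⊆ ∘ p─q⊆p (old .reps) ⁅ d ⁆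
        new .dominating x∈ with old .dominating x∈
        ... | z , z∈ , xz with z ≟ᶠ d
        ...   | no z≢d = z , x∈p∧x≢y⇒x∈p-y z∈ z≢d , lift xz
        ...   | yes refl = c , x∈p∧x≢y⇒x∈p-y c∈ c≢d ,
          lift xz ◅◅ lift (Connected-sym td) ◅◅ Connected-sym (Connected-edge ∈-insertʳ) ◅◅ lift sc
        -- A connection that uses `a` has one end in the old component of `tgt a`; the
        -- representative of that component was `d`, which has been removed.
        new .separated {x} {y} x∈ y∈ xy with Connected-⊹⁻ (Connected-mono ∈-insert⁻ xy)
        ... | inj₁ xy′ = old .separated (p─q⊆p _ _ x∈) (p─q⊆p _ _ y∈) xy′
        ... | inj₂ (inj₁ (_ , ty)) = contradiction (subst (_∈ old .reps - d) y≡d y∈) (x∉p-x (old .reps) d)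
          where
          y≡d : y ≡ d
          y≡d = old .separated (p─q⊆p _ _ y∈) d∈ (Connected-sym ty ◅◅ td)
        ... | inj₂ (inj₂ (xt , _)) = contradiction (subst (_∈ old .reps - d) x≡d x∈) (x∉p-x (old .reps) d)
          where
          x≡d : x ≡ d
          x≡d = old .separated (p─q⊆p _ _ x∈) d∈ (xt ◅◅ td)
        new .count = begin
          ∣ old .reps - d ∣ + ∣ T ∪ ⁅ a ⁆ ∣  ≡⟨ cong (∣ old .reps - d ∣ +_) (∣insert∣ a∉T) ⟩
          ∣ old .reps - d ∣ + suc ∣ T ∣      ≡⟨ +-suc _ _ ⟩
          suc ∣ old .reps - d ∣ + ∣ T ∣      ≡⟨ cong (_+ ∣ T ∣) (suc∣p-x∣ (old .reps) d∈) ⟩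
          ∣ old .reps ∣ + ∣ T ∣              ≡⟨ old .count ⟩
          ∣ U ∣                              ∎
          where open ≡-Reasoning
      result : Representatives U (T ∪ ⁅ a ⁆)
      result with old .dominating (proj₁ (ins ∈-insertʳ)) | old .dominating (proj₂ (ins ∈-insertʳ))
      ... | c , c∈ , sc | d , d∈ , td = new c∈ sc d∈ td

  module _ {U T} (ins : ∀ {a} → a ∈ T → Inside U a) (ind : Independent (_∈ T)) where

    private
      open module R = Representatives (representatives U T ins ind)

    -- A nonempty `U` has at least one component, hence at least one representative; in the
    -- connected case below there is exactly one.
    independent⇒∣T∣≤∣U∣∸1 : Nonempty U → ∣ T ∣ ≤ ∣ U ∣ ∸ 1
    independent⇒∣T∣≤∣U∣∸1 (x , x∈) with R.dominating x∈
    ... | c , c∈ , _ = ∸-monoˡ-≤ 1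
      (subst (suc ∣ T ∣ ≤_) R.count (+-monoˡ-≤ ∣ T ∣ (x∈p⇒1≤∣p∣ c∈)))

    connected⇒∣U∣∸1≤∣T∣ : Nonempty U → (∀ x y → x ∈ U → y ∈ U → Connected (_∈ T) x y) →
      ∣ U ∣ ∸ 1 ≤ ∣ T ∣
    connected⇒∣U∣∸1≤∣T∣ (x , x∈) con with R.dominating x∈
    ... | c , c∈ , _ = ∸-monoˡ-≤ 1 (subst (_≤ suc ∣ T ∣) R.count (+-monoˡ-≤ ∣ T ∣ one))
      where
      one : ∣ R.reps ∣ ≤ 1
      one = subst (∣ R.reps ∣ ≤_) (∣⁅x⁆∣≡1 c) (p⊆q⇒∣p∣≤∣q∣ λ {d} d∈ →
        subst (_∈ ⁅ c ⁆) (R.separated c∈ d∈ (con c d (R.reps⊆ c∈) (R.reps⊆ d∈))) (x∈⁅x⁆ c))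

  -- Walks and cycles

  Connected⇒Walk : ∀ {T x y} → Connected (_∈ T) x y → ∃[ w ] Walk G T x y w
  Connected⇒Walk ε = [] , nil
  Connected⇒Walk ((a , a∈ , j) ◅ c) with Connected⇒Walk c
  ... | w , walk = a ∷ w , step a∈ j walk

  Walk⇒Connected : ∀ {T P x y w} → (∀ {a} → a ∈ T → a ∈ˡ w → P a) → Walk G T x y w → Connected P x y
  Walk⇒Connected f nil = ε
  Walk⇒Connected f (step a∈ j walk) = (_ , f a∈ (here refl) , j) ◅ Walk⇒Connected (λ b∈ → f b∈ ∘ there) walk

  -- In a nonempty closed walk without repeated edges, everything after the first edge avoids that
  -- edge and joins its ends, so it is not a bridge.
  independent⇒acyclic : ∀ {T} → Independent (_∈ T) → Acyclic G T
  independent⇒acyclic ind x .[] nil _ = refl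
  independent⇒acyclic {T} ind x (a ∷ w) (step a∈ j walk) (a∉w ∷ _) = ⊥-elim (ind a a∈ (close j))
    where
    rest : Connected ((_∈ T) ∖ a) _ x
    rest = Walk⇒Connected (λ b∈T b∈w → b∈T , λ { refl → All.lookup a∉w b∈w refl }) walk
    close : Joins G a x _ → Connected ((_∈ T) ∖ a) (src a) (tgt a)
    close (inj₁ refl) = Connected-sym rest
    close (inj₂ refl) = rest

-- Packing forests

module Packing (G : Graph) (k : ℕ) where

  open Connectivity G

  -- Partial colourings, with `nothing` for an uncoloured edge; colour classes are disjoint by
  -- construction.
  Colouring : Set
  Colouring = E → Maybe (Fin k)

  Class : Colouring → Fin k → E → Set
  Class c i a = c a ≡ just i

  class? : ∀ c i → Decidable (Class c i)
  class? c i a = ≡-dec _≟ᶠ_ (c a) (just i)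

  Forests : Colouring → Set
  Forests c = ∀ i → Independent (Class c i)

  Colours : Colouring → Subset (m G) → Set
  Colours c X = (∀ {a} → a ∈ X → ∃[ i ] Class c i a) × (∀ {a i} → Class c i a → a ∈ X)

  _[_≔_] : Colouring → E → Maybe (Fin k) → Colouring
  c [ f ≔ o ] = updateAt c f (const o)

  Class-≔⁻ : ∀ c f o {i b} → Class (c [ f ≔ o ]) i b → (b ≡ f × o ≡ just i) ⊎ (b ≢ f × Class c i b)
  Class-≔⁻ c f o {i} {b} eq with b ≟ᶠ f
  ... | yes refl = inj₁ (refl , trans (sym (updateAt-updates f c)) eq)
  ... | no b≢f = inj₂ (b≢f , trans (sym (updateAt-minimal b f c b≢f)) eq)

  Class-≔-same : ∀ c f i → Class (c [ f ≔ just i ]) i f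
  Class-≔-same c f i = updateAt-updates f c

  Class-≔-other : ∀ c f o {i b} → b ≢ f → Class c i b → Class (c [ f ≔ o ]) i b
  Class-≔-other c f o {b = b} b≢f eq = trans (updateAt-minimal b f c b≢f) eq

  -- The obstruction to colouring: each of the `k` classes connects `U` by edges inside `U`, and one
  -- more edge inside `U` has no colour. `stuck⇒dense` turns this into a count.
  record Stuck (S : Subset (n G)) : Set where
    field
      colouring    : Colouring
      forests      : Forests colouring
      edge         : E
      uncoloured   : colouring edge ≡ nothing
      U            : Subset (n G)
      U⊆S          : U ⊆ S
      edge-inside  : Inside U edge
      connected    : ∀ i x y → x ∈ U → y ∈ U → Connected (λ b → Class colouring i b × Inside U b) x y

  -- Exchanges and augmentation

  module Augment (S : Subset (n G)) (X : Subset (m G)) (X⊆S : ∀ {a} → a ∈ X → Inside S a)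
    (c₀ : Colouring) (forests₀ : Forests c₀) (e₀ : E) (e₀∈X : e₀ ∈ X) (uncoloured₀ : c₀ e₀ ≡ nothing)
    (cover₀ : ∀ {a} → a ∈ X → a ≢ e₀ → ∃[ i ] Class c₀ i a)
    (within₀ : ∀ {a i} → Class c₀ i a → a ∈ X) where

    Augmented : Set
    Augmented = ∃[ c ] Forests c × Colours c X

    exchange : Colouring → E → Fin k → E → Colouring
    exchange c f i a = (c [ a ≔ nothing ]) [ f ≔ just i ]

    -- The second index is the edge currently missing. A `move` requires that deleting `a` separates
    -- the ends of `f` in class `i`, as it does when `a` lies on the cycle that `f` closes; so class
    -- `i` stays a forest.
    data Reachable : Colouring → E → Set where
      start : Reachable c₀ e₀
      move  : ∀ {c f} i {a} → Reachable c f → Class c i a →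
              ¬ Connected (Class c i ∖ a) (src f) (tgt f) → Reachable (exchange c f i a) a

    exchange⁻ : ∀ c f i a {j b} → Class (exchange c f i a) j b →
      (b ≡ f × i ≡ j) ⊎ (b ≢ f × b ≢ a × Class c j b)
    exchange⁻ c f i a eq with Class-≔⁻ (c [ a ≔ nothing ]) f (just i) eq
    ... | inj₁ (b≡f , refl) = inj₁ (b≡f , refl)
    ... | inj₂ (b≢f , eq′) with Class-≔⁻ c a nothing eq′
    ...   | inj₁ (_ , ())
    ...   | inj₂ (b≢a , eq″) = inj₂ (b≢f , b≢a , eq″)

    -- The invariant of the exchanges: the coloured edges are exactly those of `X` other than `f`.
    record State (c : Colouring) (f : E) : Set where
      field
        forests    : Forests c
        missing∈X  : f ∈ X
        missing    : c f ≡ nothing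
        cover      : ∀ {a} → a ∈ X → a ≢ f → ∃[ i ] Class c i a
        within     : ∀ {a i} → Class c i a → a ∈ X
    open State

    state : ∀ {c f} → Reachable c f → State c f
    state start = record { forests = forests₀ ; missing∈X = e₀∈X ; missing = uncoloured₀
                         ; cover = cover₀ ; within = within₀ }
    state (move {c} {f} i {a} r ca ¬con) = record
      { forests = forests′ ; missing∈X = within s ca ; missing = missing′ ; cover = cover′ ; within = within′ }
      where
      s : State c f
      s = state r
      f≢a : f ≢ a
      f≢a refl with trans (sym (missing s)) ca
      ... | ()
      missing′ : exchange c f i a a ≡ nothing
      missing′ = trans (updateAt-minimal a f (c [ a ≔ nothing ]) (f≢a ∘ sym)) (updateAt-updates a c)
      forests′ : Forests (exchange c f i a)
      forests′ j with i ≟ᶠ j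
      ... | yes refl = Independent-⊆ sub (Independent-⊹ (Independent-⊆ proj₁ (forests s i)) ¬con)
        where
        sub : ∀ {b} → Class (exchange c f i a) i b → ((Class c i ∖ a) ⊹ f) b
        sub eq with exchange⁻ c f i a eq
        ... | inj₁ (b≡f , _) = inj₂ b≡f
        ... | inj₂ (_ , b≢a , cb) = inj₁ (cb , b≢a)
      ... | no i≢j = Independent-⊆ sub (forests s j)
        where
        sub : ∀ {b} → Class (exchange c f i a) j b → Class c j b
        sub eq with exchange⁻ c f i a eq
        ... | inj₁ (_ , i≡j) = contradiction i≡j i≢j
        ... | inj₂ (_ , _ , cb) = cb
      cover′ : ∀ {b} → b ∈ X → b ≢ a → ∃[ j ] Class (exchange c f i a) j b
      cover′ {b} b∈X b≢a with b ≟ᶠ f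
      ... | yes refl = i , Class-≔-same (c [ a ≔ nothing ]) f i
      ... | no b≢f with cover s b∈X b≢f
      ...   | j , cb = j , Class-≔-other (c [ a ≔ nothing ]) f (just i) b≢f
                             (Class-≔-other c a nothing b≢a cb)
      within′ : ∀ {b j} → Class (exchange c f i a) j b → b ∈ X
      within′ eq with exchange⁻ c f i a eq
      ... | inj₁ (refl , _) = missing∈X s
      ... | inj₂ (_ , _ , cb) = within s cb

    -- The missing edge joins two components of class `i`, so it can take colour `i`, and then
    -- nothing in `X` is left uncoloured.
    augment : ∀ {c f} i → Reachable c f → ¬ Connected (Class c i) (src f) (tgt f) → Augmented
    augment {c} {f} i r ¬con = c [ f ≔ just i ] , forests′ , cover′ , within′
      where
      s : State c f
      s = state r
      forests′ : Forests (c [ f ≔ just i ])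
      forests′ j with i ≟ᶠ j
      ... | yes refl = Independent-⊆ sub (Independent-⊹ (forests s i) ¬con)
        where
        sub : ∀ {b} → Class (c [ f ≔ just i ]) i b → (Class c i ⊹ f) b
        sub eq with Class-≔⁻ c f (just i) eq
        ... | inj₁ (b≡f , _) = inj₂ b≡f
        ... | inj₂ (_ , cb) = inj₁ cb
      ... | no i≢j = Independent-⊆ sub (forests s j)
        where
        sub : ∀ {b} → Class (c [ f ≔ just i ]) j b → Class c j b
        sub eq with Class-≔⁻ c f (just i) eq
        ... | inj₁ (_ , refl) = contradiction refl i≢j
        ... | inj₂ (_ , cb) = cb
      cover′ : ∀ {b} → b ∈ X → ∃[ j ] Class (c [ f ≔ just i ]) j b
      cover′ {b} b∈X with b ≟ᶠ f
      ... | yes refl = i , Class-≔-same c f i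
      ... | no b≢f with cover s b∈X b≢f
      ...   | j , cb = j , Class-≔-other c f (just i) b≢f cb
      within′ : ∀ {b j} → Class (c [ f ≔ just i ]) j b → b ∈ X
      within′ eq with Class-≔⁻ c f (just i) eq
      ... | inj₁ (refl , _) = missing∈X s
      ... | inj₂ (_ , cb) = within s cb

    module _ (R : Subset (m G)) where

      -- Here `R` is the set of edges already known to become missing; progress completes the
      -- colouring or enlarges `R`.
      Progress : Set
      Progress = Augmented ⊎ (∃[ a ] a ∉ R × ∃[ c ] Reachable c a)

      -- If class `i` does not join the ends of `f`, then `f` can be coloured. If it joins them but
      -- not within `R`, the path contains an edge outside `R`, and a move makes that edge the
      -- missing one.
      missing-connected : ∀ {c f} i → Reachable c f →
        Progress ⊎ Connected (λ b → Class c i b × b ∈ R) (src f) (tgt f)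
      missing-connected {c} {f} i r
        with connected? (class? c i) (src f) (tgt f)
           | connected? (λ b → class? c i b ×-dec b ∈? R) (src f) (tgt f)
      ... | no ¬con | _ = inj₁ (inj₁ (augment i r ¬con))
      ... | yes _ | yes con = inj₂ con
      ... | yes con | no ¬con with cut-edge-outside (class? c i) (forests (state r) i) R con ¬con
      ...   | a , a∉R , ca , cut = inj₁ (inj₂ (a , a∉R , _ , move i r ca cut))

      -- Undoing a move: the path of missing-connected replaces the edge that the move coloured.
      pull-back : ∀ {c f} i → Reachable c f → ∀ {x y} →
        Connected (λ b → Class c i b × b ∈ R) x y →
        Progress ⊎ Connected (λ b → Class c₀ i b × b ∈ R) x y
      pull-back i start con = inj₂ con
      pull-back j (move {c} {f} i {a} r ca cut) con with missing-connected i r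
      ... | inj₁ progress = inj₁ progress
      ... | inj₂ path = pull-back j r (Connected-replace undo con)
        where
        undo : ∀ b → Class (exchange c f i a) j b × b ∈ R →
          Connected (λ b → Class c j b × b ∈ R) (src b) (tgt b)
        undo b (eq , b∈R) with exchange⁻ c f i a eq
        ... | inj₁ (refl , refl) = path
        ... | inj₂ (_ , _ , cb) = Connected-edge (cb , b∈R)

      -- `U` is the component of `e₀` in `R`. Two of its vertices are joined in `R`; each edge on
      -- the way is replaced by a path of class `i` within `R`, and such paths never leave `U`.
      stuck : e₀ ∈ R → (∀ {f} → f ∈ R → f ∈ X) →
        (∀ f → f ∈ R → ∀ i → Connected (λ b → Class c₀ i b × b ∈ R) (src f) (tgt f)) → Stuck S
      stuck e₀∈R R⊆X con = record
        { colouring = c₀ ; forests = forests₀ ; edge = e₀ ; uncoloured = uncoloured₀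
        ; U = U ; U⊆S = U⊆S ; edge-inside = ∈⟦⟧⁺ U? ε , ∈⟦⟧⁺ U? (Connected-edge e₀∈R)
        ; connected = connected }
        where
        U? : Decidable (Connected (_∈ R) (src e₀))
        U? = connected? (_∈? R) (src e₀)
        U : Subset (n G)
        U = ⟦ U? ⟧
        stays : ∀ {x y} → x ∈ S → Connected (_∈ R) x y → y ∈ S
        stays x∈ ε = x∈
        stays _ ((a , a∈ , inj₁ refl) ◅ w) = stays (proj₂ (X⊆S (R⊆X a∈))) w
        stays _ ((a , a∈ , inj₂ refl) ◅ w) = stays (proj₁ (X⊆S (R⊆X a∈))) w
        U⊆S : U ⊆ S
        U⊆S x∈ = stays (proj₁ (X⊆S e₀∈X)) (∈⟦⟧⁻ U? x∈)
        restrict : ∀ i {x y} → x ∈ U → Connected (λ b → Class c₀ i b × b ∈ R) x y →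
          Connected (λ b → Class c₀ i b × Inside U b) x y
        restrict i x∈ ε = ε
        restrict i x∈ ((a , (ca , a∈R) , j) ◅ w) = (a , (ca , ins j) , j) ◅ restrict i y∈ w
          where
          y∈ : _ ∈ U
          y∈ = ∈⟦⟧⁺ U? (∈⟦⟧⁻ U? x∈ ◅◅ (a , a∈R , j) ◅ ε)
          ins : Joins G a _ _ → Inside U a
          ins (inj₁ refl) = x∈ , y∈
          ins (inj₂ refl) = y∈ , x∈
        connected : ∀ i x y → x ∈ U → y ∈ U → Connected (λ b → Class c₀ i b × Inside U b) x y
        connected i x y x∈ y∈ = restrict i x∈ (Connected-replace (λ f f∈R → con f f∈R i)
          (Connected-sym (∈⟦⟧⁻ U? x∈) ◅◅ ∈⟦⟧⁻ U? y∈))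

    -- Each edge of `R` is missing in a colouring of its own; pulling back makes all the resulting
    -- connections speak of the single colouring `c₀`.
    progress-or-closed : ∀ R → (∀ {f} → f ∈ R → ∃[ c ] Reachable c f) → ∀ f →
      Progress R ⊎ (f ∈ R → ∀ i → Connected (λ b → Class c₀ i b × b ∈ R) (src f) (tgt f))
    progress-or-closed R reach f with f ∈? R
    ... | no f∉R = inj₂ λ f∈R → contradiction f∈R f∉R
    ... | yes f∈R with reach f∈R
    ...   | c , r with ⊎-distribʳ-∀ (λ i → [ inj₁ , pull-back R i r ]′ (missing-connected R i r))
    ...     | inj₁ progress = inj₁ progress
    ...     | inj₂ con = inj₂ λ _ → con

    -- `j` is fuel: each round without an outcome adds a new edge to `R`, and at `j = 0` the set `R`
    -- would have more than `m G` elements.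
    grow : ∀ j R → m G < ∣ R ∣ + j → e₀ ∈ R → (∀ {f} → f ∈ R → ∃[ c ] Reachable c f) → Stuck S ⊎ Augmented
    grow zero R lt _ _ = contradiction (≤-trans lt (≤-reflexive (+-identityʳ _))) (≤⇒≯ (∣p∣≤n R))
    grow (suc j) R lt e₀∈R reach with ⊎-distribʳ-∀ (progress-or-closed R reach)
    ... | inj₂ con = inj₁ (stuck R e₀∈R (λ f∈R → missing∈X (state (proj₂ (reach f∈R)))) con)
    ... | inj₁ (inj₁ augmented) = inj₂ augmented
    ... | inj₁ (inj₂ (a , a∉R , c , r)) =
      grow j (R ∪ ⁅ a ⁆) lt′ (∈-insertˡ e₀∈R) λ f∈ → [ reach , (λ { refl → c , r }) ]′ (∈-insert⁻ f∈)
      where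
      lt′ : m G < ∣ R ∪ ⁅ a ⁆ ∣ + j
      lt′ = subst (m G <_) (trans (+-suc ∣ R ∣ j) (cong (_+ j) (sym (∣insert∣ a∉R)))) lt

    stuck-or-augmented : Stuck S ⊎ Augmented
    stuck-or-augmented = grow (suc (m G)) ⁅ e₀ ⁆ (m≤n+m _ ∣ ⁅ e₀ ⁆ ∣) (x∈⁅x⁆ e₀)
      λ f∈ → subst (λ f → ∃[ c ] Reachable c f) (sym (x∈⁅y⁆⇒x≡y e₀ f∈)) (c₀ , start)

  -- `Stuck S` does not mention `X`, so an obstruction met while only some of the edges are treated
  -- is passed on unchanged.
  stuck-or-coloured : ∀ S X → (∀ {a} → a ∈ X → Inside S a) →
    Stuck S ⊎ ∃[ c ] Forests c × Colours c X
  stuck-or-coloured S = subset-induction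
    (λ X → (∀ {a} → a ∈ X → Inside S a) → Stuck S ⊎ ∃[ c ] Forests c × Colours c X)
    (λ _ → inj₂ (const nothing , (λ i a ()) , (λ a∈ → contradiction a∈ ∉⊥) , λ ()))
    add
    where
    add : ∀ X a → a ∉ X → ((∀ {b} → b ∈ X → Inside S b) → Stuck S ⊎ ∃[ c ] Forests c × Colours c X) →
      (∀ {b} → b ∈ X ∪ ⁅ a ⁆ → Inside S b) → Stuck S ⊎ ∃[ c ] Forests c × Colours c (X ∪ ⁅ a ⁆)
    add X a a∉X ih ins with ih (ins ∘ ∈-insertˡ)
    ... | inj₁ st = inj₁ st
    ... | inj₂ (c , forests , cover , within) =
      Augment.stuck-or-augmented S (X ∪ ⁅ a ⁆) ins c forests a ∈-insertʳ ca cover′ (∈-insertˡ ∘ within)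
      where
      ca : c a ≡ nothing
      ca with c a in eq
      ... | nothing = refl
      ... | just i = contradiction (within eq) a∉X
      cover′ : ∀ {b} → b ∈ X ∪ ⁅ a ⁆ → b ≢ a → ∃[ i ] Class c i b
      cover′ b∈ b≢a with ∈-insert⁻ b∈
      ... | inj₁ b∈X = cover b∈X
      ... | inj₂ b≡a = contradiction b≡a b≢a

-- A smallest dense vertex set

module Dense (G : Graph) (k : ℕ) where

  open Connectivity G
  open Packing G k

  edgesIn : Subset (n G) → Subset (m G)
  edgesIn U = ⟦ inside? U ⟧

  IsDense : Subset (n G) → Set
  IsDense U = k * (∣ U ∣ ∸ 1) < ∣ edgesIn U ∣

  NoSmallerDense : Subset (n G) → Set
  NoSmallerDense S = ∀ U → ∣ U ∣ < ∣ S ∣ → ¬ IsDense U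

  -- Descent on the size of `U`, bounded by `j`; density is decidable, so all smaller subsets can be
  -- searched.
  smallest-dense : ∀ j U → ∣ U ∣ < j → IsDense U → ∃[ S ] IsDense S × NoSmallerDense S
  smallest-dense (suc j) U (s≤s ∣U∣≤j) dense
    with anySubset? (λ W → (∣ W ∣ <? ∣ U ∣) ×-dec (k * (∣ W ∣ ∸ 1) <? ∣ edgesIn W ∣))
  ... | yes (W , smaller , dense′) = smallest-dense j W (<-≤-trans smaller ∣U∣≤j) dense′
  ... | no none = U , dense , λ W smaller dense′ → none (W , smaller , dense′)

  -- Density forces an edge inside `U`. In particular the empty set, where `∸` makes the bound zero,
  -- is not dense.
  dense⇒nonempty : ∀ {U} → IsDense U → Nonempty U
  dense⇒nonempty {U} dense with nonempty? (edgesIn U)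
  ... | yes (a , a∈) = _ , proj₁ (∈⟦⟧⁻ (inside? U) a∈)
  ... | no empty = contradiction (subst (λ p → k * (∣ U ∣ ∸ 1) < ∣ p ∣) (Empty-unique empty) dense)
    λ lt → n≮0 (subst (k * (∣ U ∣ ∸ 1) <_) (∣⊥∣≡0 (m G)) lt)

  classIn : Colouring → Subset (n G) → Fin k → Subset (m G)
  classIn c U i = ⟦ (λ b → class? c i b ×-dec inside? U b) ⟧

  module _ (c : Colouring) (forests : Forests c) (U : Subset (n G)) where

    ∈classIn⁻ : ∀ i {b} → b ∈ classIn c U i → Class c i b × Inside U b
    ∈classIn⁻ i = ∈⟦⟧⁻ (λ b → class? c i b ×-dec inside? U b)

    ∈classIn⁺ : ∀ i {b} → Class c i b × Inside U b → b ∈ classIn c U i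
    ∈classIn⁺ i = ∈⟦⟧⁺ (λ b → class? c i b ×-dec inside? U b)

    classIn-independent : ∀ i → Independent (_∈ classIn c U i)
    classIn-independent i = Independent-⊆ (proj₁ ∘ ∈classIn⁻ i) (forests i)

    classIn-disjoint : ∀ i j {b} → b ∈ classIn c U i → b ∈ classIn c U j → i ≡ j
    classIn-disjoint i j b∈i b∈j =
      just-injective (trans (sym (proj₁ (∈classIn⁻ i b∈i))) (proj₁ (∈classIn⁻ j b∈j)))

    coloured⇒¬dense : (∀ {b} → b ∈ edgesIn U → ∃[ i ] Class c i b) → ¬ IsDense U
    coloured⇒¬dense cover dense = <⇒≱ dense (≤-trans (p⊆q⇒∣p∣≤∣q∣ covered)
      (∣⋃ᶠ∣≤ (classIn c U) _ λ i → independent⇒∣T∣≤∣U∣∸1 (proj₂ ∘ ∈classIn⁻ i)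
        (classIn-independent i) (dense⇒nonempty dense)))
      where
      covered : edgesIn U ⊆ ⋃ᶠ (classIn c U)
      covered b∈ with cover b∈
      ... | i , cb = ∈⋃ᶠ⁺ (classIn c U) i (∈classIn⁺ i (cb , ∈⟦⟧⁻ (inside? U) b∈))

    stuck⇒dense : ∀ a → c a ≡ nothing → Inside U a →
      (∀ i x y → x ∈ U → y ∈ U → Connected (_∈ classIn c U i) x y) → IsDense U
    stuck⇒dense a ca a∈ con = begin-strict
      k * (∣ U ∣ ∸ 1)                ≤⟨ ∣⋃ᶠ∣≥ (classIn c U) _ (λ i → connected⇒∣U∣∸1≤∣T∣
                                         (proj₂ ∘ ∈classIn⁻ i) (classIn-independent i)
                                         (_ , proj₁ a∈) (con i)) classIn-disjoint ⟩
      -- The uncoloured edge `a` supplies the strict inequality.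
      ∣ ⋃ᶠ (classIn c U) ∣           <⟨ n<1+n _ ⟩
      suc ∣ ⋃ᶠ (classIn c U) ∣       ≡⟨ ∣insert∣ a∉ ⟨
      ∣ ⋃ᶠ (classIn c U) ∪ ⁅ a ⁆ ∣   ≤⟨ p⊆q⇒∣p∣≤∣q∣ within ⟩
      ∣ edgesIn U ∣                  ∎
      where
      open ≤-Reasoning
      a∉ : a ∉ ⋃ᶠ (classIn c U)
      a∉ a∈⋃ with ∈⋃ᶠ⁻ (classIn c U) a∈⋃
      ... | i , a∈ᵢ with trans (sym ca) (proj₁ (∈classIn⁻ i a∈ᵢ))
      ...   | ()
      within : ⋃ᶠ (classIn c U) ∪ ⁅ a ⁆ ⊆ edgesIn U
      within b∈ with ∈-insert⁻ b∈
      ... | inj₂ refl = ∈⟦⟧⁺ (inside? U) a∈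
      ... | inj₁ b∈⋃ with ∈⋃ᶠ⁻ (classIn c U) b∈⋃
      ...   | i , b∈ᵢ = ∈⟦⟧⁺ (inside? U) (proj₂ (∈classIn⁻ i b∈ᵢ))

  induced : Subset (n G) → Subgraph G
  induced U = record { S = U ; F = edgesIn U ; closed = λ a → ∈⟦⟧⁻ (inside? U) }

  -- Properties of a smallest dense set

  module _ (S : Subset (n G)) (dense : IsDense S) (smallest : NoSmallerDense S) where

    private
      S-nonempty : Nonempty S
      S-nonempty = dense⇒nonempty dense

    disjoint-spanning-trees : HasDisjointSpanningTrees k (induced S)
    disjoint-spanning-trees with stuck-or-coloured S (edgesIn S) (∈⟦⟧⁻ (inside? S))
    ... | inj₂ (c , forests , cover , _) = contradiction dense (coloured⇒¬dense c forests S cover)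
    ... | inj₁ st = classIn colouring S , (λ i →
          (λ b∈ → ∈⟦⟧⁺ (inside? S) (proj₂ (∈classIn⁻ colouring forests S i b∈)))
        , (λ x y x∈ y∈ → Connected⇒Walk (Connected-mono (∈classIn⁺ colouring forests S i ∘ widen)
             (connected i x y (S⊆U x∈) (S⊆U y∈))))
        , independent⇒acyclic (classIn-independent colouring forests S i))
      , λ i j i≢j (b , b∈) → let b∈i , b∈j = x∈p∩q⁻ (classIn colouring S i) _ b∈ in
          i≢j (classIn-disjoint colouring forests S i j b∈i b∈j)
      where
      open Stuck st
      U-dense : IsDense U
      U-dense = stuck⇒dense colouring forests U edge uncoloured edge-inside
        λ i x y x∈ y∈ → Connected-mono (∈classIn⁺ colouring forests U i) (connected i x y x∈ y∈)
      S⊆U : S ⊆ U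
      S⊆U {x} x∈ with x ∈? U
      ... | yes x∈U = x∈U
      -- A vertex of `S` outside `U` would make `U` a smaller dense set.
      ... | no x∉U = contradiction U-dense (smallest U (p⊂q⇒∣p∣<∣q∣ (U⊆S , x , x∈ , x∉U)))
      widen : ∀ {P : Set} {b} → P × Inside U b → P × Inside S b
      widen (p , s , t) = p , U⊆S s , U⊆S t

    -- With `B` the rest of `S`, every edge inside `S` lies in `A`, lies in `B` or crosses. The
    -- bounds for `A` and `B` fall short of the one for `S` by at least `k`, and strictness of
    -- `dense` gives one more crossing edge.
    edge-connected : EdgeConnected (suc k) (induced S)
    edge-connected A A⊆S (x , x∈A) (y , y∈S , y∉A) = bound
      where
      B? : Decidable (λ z → z ∈ S × z ∉ A)
      B? z = z ∈? S ×-dec ¬? (z ∈? A)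
      B : Subset (n G)
      B = ⟦ B? ⟧
      ∣A∣+∣B∣≤∣S∣ : ∣ A ∣ + ∣ B ∣ ≤ ∣ S ∣
      ∣A∣+∣B∣≤∣S∣ = subst (_≤ ∣ S ∣) (disjoint⇒∣p∪q∣≡∣p∣+∣q∣ A B disj) (p⊆q⇒∣p∣≤∣q∣ sub)
        where
        disj : Empty (A ∩ B)
        disj (z , z∈) with x∈p∩q⁻ A B z∈
        ... | z∈A , z∈B = proj₂ (∈⟦⟧⁻ B? z∈B) z∈A
        sub : A ∪ B ⊆ S
        sub z∈ = [ A⊆S , proj₁ ∘ ∈⟦⟧⁻ B? ]′ (x∈p∪q⁻ A B z∈)
      1≤∣A∣ : 1 ≤ ∣ A ∣
      1≤∣A∣ = x∈p⇒1≤∣p∣ x∈A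
      1≤∣B∣ : 1 ≤ ∣ B ∣
      1≤∣B∣ = x∈p⇒1≤∣p∣ (∈⟦⟧⁺ B? (y∈S , y∉A))
      cross : Subset (m G)
      cross = crossing (induced S) A
      ∉⇒lookup : ∀ {z} → z ∉ A → lookup A z ≡ false
      ∉⇒lookup {z} z∉ with lookup A z in eq
      ... | true = contradiction (lookup⇒[]= z A eq) z∉
      ... | false = refl
      ∈cross : ∀ {a s t} → a ∈ edgesIn S → lookup A (src a) ≡ s → lookup A (tgt a) ≡ t →
        s xor t ≡ true → a ∈ cross
      ∈cross {a} a∈ refl refl s≢t = lookup⇒[]= a cross
        (trans (lookup∘tabulate _ a) (cong₂ _∧_ ([]=⇒lookup a∈) s≢t))
      split : edgesIn S ⊆ (edgesIn A ∪ edgesIn B) ∪ cross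
      split {a} a∈ with ∈⟦⟧⁻ (inside? S) a∈ | src a ∈? A | tgt a ∈? A
      ... | _ | yes s∈ | yes t∈ = x∈p∪q⁺ (inj₁ (x∈p∪q⁺ (inj₁ (∈⟦⟧⁺ (inside? A) (s∈ , t∈)))))
      ... | s∈S , t∈S | no s∉ | no t∉ = x∈p∪q⁺ (inj₁ (x∈p∪q⁺ (inj₂
        (∈⟦⟧⁺ (inside? B) (∈⟦⟧⁺ B? (s∈S , s∉) , ∈⟦⟧⁺ B? (t∈S , t∉))))))
      ... | _ | yes s∈ | no t∉ = x∈p∪q⁺ (inj₂ (∈cross a∈ ([]=⇒lookup s∈) (∉⇒lookup t∉) refl))
      ... | _ | no s∉ | yes t∈ = x∈p∪q⁺ (inj₂ (∈cross a∈ (∉⇒lookup s∉) ([]=⇒lookup t∈) refl))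
      parts : ∀ p q → 1 ≤ p → 1 ≤ q → k + (k * (p ∸ 1) + k * (q ∸ 1)) ≡ k * (p + q ∸ 1)
      parts (suc p) (suc q) _ _ = solve 3 (λ k p q → k :+ (k :* p :+ k :* q) := k :* (p :+ (con 1 :+ q)))
        refl k p q
        where open +-*-Solver
      bound : suc k ≤ ∣ cross ∣
      bound = +-cancelʳ-≤ (k * (∣ A ∣ ∸ 1) + k * (∣ B ∣ ∸ 1)) _ _ (begin
        suc (k + (k * (∣ A ∣ ∸ 1) + k * (∣ B ∣ ∸ 1)))     ≡⟨ cong suc (parts _ _ 1≤∣A∣ 1≤∣B∣) ⟩
        suc (k * (∣ A ∣ + ∣ B ∣ ∸ 1))                     ≤⟨ s≤s (*-monoʳ-≤ k (∸-monoˡ-≤ 1 ∣A∣+∣B∣≤∣S∣)) ⟩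
        suc (k * (∣ S ∣ ∸ 1))                             ≤⟨ dense ⟩
        ∣ edgesIn S ∣                                     ≤⟨ p⊆q⇒∣p∣≤∣q∣ split ⟩
        ∣ (edgesIn A ∪ edgesIn B) ∪ cross ∣               ≤⟨ ∣p∪q∣≤∣p∣+∣q∣ (edgesIn A ∪ edgesIn B) cross ⟩
        ∣ edgesIn A ∪ edgesIn B ∣ + ∣ cross ∣             ≤⟨ +-monoˡ-≤ ∣ cross ∣
          (∣p∪q∣≤∣p∣+∣q∣ (edgesIn A) (edgesIn B)) ⟩
        ∣ edgesIn A ∣ + ∣ edgesIn B ∣ + ∣ cross ∣         ≤⟨ +-monoˡ-≤ ∣ cross ∣ (+-mono-≤
          -- Each side is smaller than `S` because the other is nonempty, so neither is dense.
          (≮⇒≥ (smallest A (<-≤-trans (m<m+n ∣ A ∣ 1≤∣B∣) ∣A∣+∣B∣≤∣S∣)))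
          (≮⇒≥ (smallest B (<-≤-trans (m<n+m ∣ B ∣ 1≤∣A∣) ∣A∣+∣B∣≤∣S∣)))) ⟩
        k * (∣ A ∣ ∸ 1) + k * (∣ B ∣ ∸ 1) + ∣ cross ∣     ≡⟨ +-comm _ ∣ cross ∣ ⟩
        ∣ cross ∣ + (k * (∣ A ∣ ∸ 1) + k * (∣ B ∣ ∸ 1))   ∎)
        where open ≤-Reasoning

    -- The inequality passed to `large` is the bound `u (u − 1) / 2` on the edges among `u`
    -- vertices, freed of division and subtraction. It is proved for every vertex set by adding
    -- vertices one at a time.
    simple⇒2k<∣S∣ : Simple G → 2 * k < ∣ S ∣
    simple⇒2k<∣S∣ simple = large (∣ S ∣) (∣ edgesIn S ∣) (x∈p⇒1≤∣p∣ (proj₂ S-nonempty)) dense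
      (subset-induction (λ U → 2 * ∣ edgesIn U ∣ + ∣ U ∣ ≤ ∣ U ∣ * ∣ U ∣) base add S)
      where
      same : ∀ {x a b y} → Joins G a x y → Joins G b x y → a ≡ b
      same {a = a} {b} j j′ with a ≟ᶠ b
      ... | yes a≡b = a≡b
      ... | no a≢b = contradiction (parallel j j′) (simple a b a≢b)
        where
        parallel : ∀ {x y} → Joins G a x y → Joins G b x y →
          (ends G a ≡ ends G b) ⊎ (ends G a ≡ swap (ends G b))
        parallel (inj₁ p) (inj₁ q) = inj₁ (trans p (sym q))
        parallel (inj₁ p) (inj₂ q) = inj₂ (trans p (cong swap (sym q)))
        parallel (inj₂ p) (inj₁ q) = inj₂ (trans p (cong swap (sym q)))
        parallel (inj₂ p) (inj₂ q) = inj₁ (trans p (sym q))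
      base : 2 * ∣ edgesIn ⊥ ∣ + ∣ ⊥ {n G} ∣ ≤ ∣ ⊥ {n G} ∣ * ∣ ⊥ {n G} ∣
      base = subst₂ (λ p q → 2 * ∣ p ∣ + q ≤ q * q) (sym (Empty-unique none)) (sym (∣⊥∣≡0 (n G)))
        (≤-reflexive (trans (+-identityʳ _) (cong (2 *_) (∣⊥∣≡0 (m G)))))
        where
        none : Empty (edgesIn ⊥)
        none (a , a∈) = ∉⊥ (proj₁ (∈⟦⟧⁻ (inside? ⊥) a∈))
      square : ∀ E D u → 2 * E + u ≤ u * u → D ≤ u → 2 * (E + D) + suc u ≤ suc u * suc u
      square E D u h D≤u = begin
        2 * (E + D) + suc u              ≡⟨ solve 3 (λ E D u → con 2 :* (E :+ D) :+ (con 1 :+ u)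
                                              := (con 2 :* E :+ u) :+ (con 2 :* D :+ con 1)) refl E D u ⟩
        (2 * E + u) + (2 * D + 1)        ≤⟨ +-mono-≤ h (+-monoˡ-≤ 1 (*-monoʳ-≤ 2 D≤u)) ⟩
        u * u + (2 * u + 1)              ≡⟨ solve 1 (λ u → u :* u :+ (con 2 :* u :+ con 1)
                                              := (con 1 :+ u) :* (con 1 :+ u)) refl u ⟩
        suc u * suc u                    ∎
        where
        open ≤-Reasoning
        open +-*-Solver
      add : ∀ U x → x ∉ U → 2 * ∣ edgesIn U ∣ + ∣ U ∣ ≤ ∣ U ∣ * ∣ U ∣ →
        2 * ∣ edgesIn (U ∪ ⁅ x ⁆) ∣ + ∣ U ∪ ⁅ x ⁆ ∣ ≤ ∣ U ∪ ⁅ x ⁆ ∣ * ∣ U ∪ ⁅ x ⁆ ∣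
      -- The additional edges form the star from `x` into `U`. By simplicity an edge of the star is
      -- determined by its other end, so there are at most `∣ U ∣` of them.
      add U x x∉U ih rewrite ∣insert∣ x∉U = ≤-trans
        (+-monoˡ-≤ (suc ∣ U ∣) (*-monoʳ-≤ 2
          (≤-trans (p⊆q⇒∣p∣≤∣q∣ split) (∣p∪q∣≤∣p∣+∣q∣ (edgesIn U) star))))
        (square (∣ edgesIn U ∣) (∣ star ∣) (∣ U ∣) ih
          (∣∣≤-by-injective-relation (λ a y → Joins G a x y) star U (∈⟦⟧⁻ star?) same))
        where
        star? : Decidable (λ a → ∃[ y ] y ∈ U × Joins G a x y)
        star? a = any? λ y → y ∈? U ×-dec (ends≟ (ends G a) (x , y) ⊎-dec ends≟ (ends G a) (y , x))
          where
          ends≟ : (p q : V × V) → Dec (p ≡ q)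
          ends≟ = Product.≡-dec _≟ᶠ_ _≟ᶠ_
        star : Subset (m G)
        star = ⟦ star? ⟧
        split : edgesIn (U ∪ ⁅ x ⁆) ⊆ edgesIn U ∪ star
        split {a} a∈ with ∈⟦⟧⁻ (inside? (U ∪ ⁅ x ⁆)) a∈
        ... | s∈ , t∈ with ∈-insert⁻ s∈ | ∈-insert⁻ t∈
        ...   | inj₁ s∈U | inj₁ t∈U = x∈p∪q⁺ (inj₁ (∈⟦⟧⁺ (inside? U) (s∈U , t∈U)))
        ...   | inj₁ s∈U | inj₂ t≡x = x∈p∪q⁺ (inj₂ (∈⟦⟧⁺ star? (_ , s∈U , inj₂ (cong (src a ,_) t≡x))))
        ...   | inj₂ s≡x | inj₁ t∈U = x∈p∪q⁺ (inj₂ (∈⟦⟧⁺ star? (_ , t∈U , inj₁ (cong (_, tgt a) s≡x))))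
        ...   | inj₂ s≡x | inj₂ t≡x = contradiction (trans s≡x (sym t≡x)) (noLoop G a)
      large : ∀ s E → 1 ≤ s → k * (s ∸ 1) < E → 2 * E + s ≤ s * s → 2 * k < s
      -- With `s = t + 1` the chain reads `2kt < 2E ≤ (t + 1) t`; its strictness excludes `t = 0`,
      -- so `t` cancels.
      large (suc t) E _ dense h = *-cancelʳ-< t (2 * k) (suc t) (begin-strict
        2 * k * t     ≡⟨ *-assoc 2 k t ⟩
        2 * (k * t)   <⟨ *-monoʳ-< 2 dense ⟩
        2 * E         ≤⟨ +-cancelʳ-≤ (suc t) _ _ (≤-trans h (≤-reflexive (+-comm (suc t) (t * suc t)))) ⟩
        t * suc t     ≡⟨ *-comm t (suc t) ⟩
        suc t * t     ∎)
        where open ≤-Reasoning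

  -- This turns the hypothesis on `G` into density of the full vertex set, from which the descent
  -- starts.
  edgesIn-⊤ : ∣ edgesIn ⊤ ∣ ≡ m G
  edgesIn-⊤ = trans (cong ∣_∣ (⊆-antisym ⊆⊤ λ _ → ∈⟦⟧⁺ (inside? ⊤) (∈⊤ , ∈⊤))) (∣⊤∣≡n (m G))

theorem4 : (k : ℕ) → 1 ≤ k → (G : Graph) → k * (v G ∸ 1) < e G →
    Σ (Subgraph G) λ G′ →
    (k * (vs G′ ∸ 1) < es G′)
    × EdgeConnected (suc k) G′
    × HasDisjointSpanningTrees k G′
    × (Simple G → 2 * k < vs G′)
theorem4 k _ G G-dense = result (smallest-dense _ ⊤ (n<1+n _)
    (subst₂ (λ p q → k * (p ∸ 1) < q) (sym (∣⊤∣≡n (n G))) (sym edgesIn-⊤) G-dense))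
  where
  open Dense G k
  result : (∃[ S ] IsDense S × NoSmallerDense S) → _
  result (S , dense , smallest) = induced S , dense , edge-connected S dense smallest ,
    disjoint-spanning-trees S dense smallest , simple⇒2k<∣S∣ S dense smallest
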